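{- A graph $G$ is a $3$-$\chi_i$-lower-game-vertex-critical graph if and only if $G$ is an odd cycle.
   Context: All graphs are simple, undirected and finite. The indicated coloring game on a graph $G$ with color set $\{1,\ldots,k\}$ is played by Ann and Ben. In every round Ann selects a previously uncolored vertex and Ben colors it with any color from $\{1,\ldots,k\}$ that has not been used on its neighbors. Ann's goal is a proper coloring of the whole graph; Ben wins if at some point there is an uncolored vertex having all colors $1,\ldots,k$ in its neighborhood. The indicated chromatic number $\chi_i(G)$ is the minimum $k$ for which Ann has a winning strategy on $G$, no matter how Ben plays. For $x\in V(G)$, $G-x$ is the graph obtained from $G$ by deleting $x$ and all edges incident with $x$. A graph $G$ is $k$-$\chi_i$-lower-game-vertex-critical if $\chi_i(G)=k$ and $\chi_i(G-x)<\chi_i(G)$ for every $x\in V(G)$. An odd cycle is a cycle graph $C_{2m+1}$ with $m\geq 1$. -}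

module Defs where

open import Data.Nat.Base using (ℕ; suc; pred; _+_; _*_; _≤_; _<_)
open import Data.Nat.Properties using () renaming (_≟_ to _≟ℕ_)
open import Data.Fin.Base using (Fin; toℕ; punchIn)
open import Data.Fin.Properties using (_≟_)
open import Data.Maybe using (Maybe; just; nothing; Is-just)
open import Data.Product.Base using (_×_; _,_; ∃-syntax)
open import Data.Sum.Base using (_⊎_; swap)
open import Data.Vec.Base using (Vec; lookup; replicate; _[_]≔_)
open import Function.Base using (_∘_)
open import Function.Bundles using (_⇔_; _↔_; Inverse)
open import Level using (0ℓ)
open import Relation.Binary.Core using (Rel)
open import Relation.Binary.Definitions using (Decidable; Symmetric; Irreflexive)
open import Relation.Binary.PropositionalEquality using (_≡_; _≢_; cong; sym)
open import Relation.Nullary.Decidable using (¬?; _×-dec_; _⊎-dec_)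
open import Relation.Nullary.Negation using (¬_)

record Graph (n : ℕ) : Set₁ where
  field
    Adj    : Rel (Fin n) 0ℓ
    adj?   : Decidable Adj
    symm   : Symmetric Adj
    irrefl : Irreflexive _≡_ Adj

open Graph public

infixl 6 _-_

-- The vertices of G - x are renumbered along the order-preserving
-- bijection punchIn x from Fin n onto Fin (suc n) without x.
_-_ : ∀ {n} → Graph n → Fin n → Graph (pred n)
_-_ {suc n} G x = record
  { Adj    = λ u v → Adj G (punchIn x u) (punchIn x v)
  ; adj?   = λ u v → adj? G (punchIn x u) (punchIn x v)
  ; symm   = symm G
  ; irrefl = irrefl G ∘ cong (punchIn x)
  }

infix 4 _≅_

record _≅_ {m n} (G : Graph m) (H : Graph n) : Set where
  field
    bijection : Fin m ↔ Fin n
    adj-⇔     : ∀ u v → Adj G u v ⇔ Adj H (Inverse.to bijection u) (Inverse.to bijection v)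

PartialColoring : ℕ → ℕ → Set
PartialColoring n k = Vec (Maybe (Fin k)) n

module IndicatedGame {n} (G : Graph n) (k : ℕ) where

  Legal : PartialColoring n k → Fin n → Fin k → Set
  Legal c v a = ∀ u → Adj G v u → lookup c u ≢ just a

  BenHasWon : PartialColoring n k → Set
  BenHasWon c = ∃[ v ] lookup c v ≡ nothing
                     × (∀ a → ∃[ u ] Adj G v u × lookup c u ≡ just a)

  -- Elements are winning strategy trees for Ann from the given position.
  -- Properness of the final coloring is guaranteed by the legality of
  -- Ben's moves.
  data AnnWinsFrom (c : PartialColoring n k) : Set where
    finished : (∀ v → Is-just (lookup c v)) → AnnWinsFrom c
    select   : ¬ BenHasWon c →
               (v : Fin n) → lookup c v ≡ nothing →
               (∀ a → Legal c v a → AnnWinsFrom (c [ v ]≔ just a)) →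
               AnnWinsFrom c

  AnnWins : Set
  AnnWins = AnnWinsFrom (replicate n nothing)

open IndicatedGame public using (AnnWins)

-- χᵢ(G) = k
IsIndicatedChromaticNumber : ∀ {n} → Graph n → ℕ → Set
IsIndicatedChromaticNumber G k = AnnWins G k × (∀ j → AnnWins G j → k ≤ j)

IsLowerGameVertexCritical : ∀ {n} → ℕ → Graph n → Set
IsLowerGameVertexCritical k G =
  IsIndicatedChromaticNumber G k ×
  (∀ x → ∃[ j ] IsIndicatedChromaticNumber (G - x) j × j < k)

Next : ∀ {n} → Rel (Fin n) 0ℓ
Next {n} i j = toℕ j ≡ suc (toℕ i) ⊎ (suc (toℕ i) ≡ n × toℕ j ≡ 0)

next? : ∀ {n} → Decidable (Next {n})
next? {n} i j = (toℕ j ≟ℕ suc (toℕ i)) ⊎-dec ((suc (toℕ i) ≟ℕ n) ×-dec (toℕ j ≟ℕ 0))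

-- The conjunct i ≢ j only matters for n = 1, where it removes the loop;
-- for n ≥ 3 this is the usual cycle graph Cₙ.
cycle : ∀ n → Graph n
cycle n = record
  { Adj    = λ i j → i ≢ j × (Next i j ⊎ Next j i)
  ; adj?   = λ i j → ¬? (i ≟ j) ×-dec (next? i j ⊎-dec next? j i)
  ; symm   = λ (i≢j , a) → i≢j ∘ sym , swap a
  ; irrefl = λ i≡j (i≢j , _) → i≢j i≡j
  }

IsOddCycle : ∀ {n} → Graph n → Set
IsOddCycle G = ∃[ m ] 1 ≤ m × G ≅ cycle (2 * m + 1)

{-# OPTIONS --safe #-}

-- Ann wins with two colors exactly on bipartite graphs, so χᵢ(G) = 3 forces an
-- odd closed walk.  A shortest one repeats no vertex and has no chord, and it
-- meets every vertex x because G - x is bipartite: it exhibits G as an odd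
-- cycle.  Conversely an odd cycle is not bipartite, deleting a vertex leaves a
-- path, and with three colors Ben can never block a vertex of degree 2.

module Submission where

open import Data.Empty using (⊥-elim)
open import Data.Fin.Base
  using (Fin; zero; suc; toℕ; fromℕ; fromℕ<; inject₁; inject≤; opposite; punchIn
    ; punchOut)
open import Data.Fin.Induction using (<-weakInduction)
open import Data.Fin.Properties
  using (_≟_; any?; ¬∀⟶∃¬; inject≤-injective; suc-injective; toℕ-injective; toℕ<n
    ; toℕ-inject₁; toℕ-fromℕ; toℕ-fromℕ<; punchIn-injective; punchInᵢ≢i
    ; punchIn-punchOut)
open import Data.Fin.Subset using (_∈_; _∪_; ⁅_⁆; _⊃_) renaming (⊥ to ∅)
open import Data.Fin.Subset.Induction using (⊃-wellFounded)
open import Data.Fin.Subset.Properties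
  using (_∈?_; ∉⊥; x∈⁅x⁆; x∈⁅y⁆⇒x≡y; x∈p∪q⁺; x∈p∪q⁻; p⊆p∪q)
open import Data.Maybe using (Maybe; just; nothing; Is-just; to-witness)
open import Data.Maybe.Properties using (just-injective; ≡-dec)
open import Data.Maybe.Relation.Unary.Any using (just)
open import Data.Nat.Base
  using (ℕ; zero; suc; pred; parity; _+_; _*_; _∸_; _≤_; _<_; z≤n; s≤s)
open import Data.Nat.Induction using (<-wellFounded)
open import Data.Nat.Properties hiding (_≟_) renaming (suc-injective to suc-injectiveℕ)
open import Data.Parity.Base as ℙ using (Parity; 0ℙ; 1ℙ; _⁻¹)
open import Data.Parity.Properties as ℙ
  using (+-homo-+; suc-homo-⁻¹; ⁻¹-involutive; p≢p⁻¹; ⁻¹-injective; *-homo-*)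
  renaming (_≟_ to _≟ℙ_)
open import Data.Product.Base using (_×_; _,_; proj₁; proj₂; ∃; ∃-syntax)
open import Data.Sum.Base using (_⊎_; inj₁; inj₂; [_,_]′)
open import Data.Unit.Base using (⊤)
open import Data.Vec.Base using (Vec; []; _∷_; lookup; _[_]≔_)
open import Data.Vec.Properties using (lookup∘update; lookup∘update′; lookup-replicate)
open import Function.Base using (_∘_; id)
open import Function.Bundles using (_⇔_; mk⇔; mk↔ₛ′; Inverse; Equivalence)
open import Induction.WellFounded using (Acc; acc)
open import Level using (0ℓ)
open import Relation.Binary.Core using (Rel)
open import Relation.Binary.Definitions using (Decidable; tri<; tri≈; tri>)
open import Relation.Binary.PropositionalEquality
  using (_≡_; _≢_; refl; sym; trans; cong; subst; subst₂; ≢-sym; module ≡-Reasoning)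
open import Relation.Nullary.Decidable using (Dec; yes; no; ¬?; _×-dec_; _⊎-dec_)
open import Relation.Nullary.Negation using (¬_; contradiction)
open import Relation.Unary using (Pred) renaming (Decidable to Decidable₁)
open import Defs

private
  variable
    n k ℓ ℓ′ i j : ℕ

-- Colorings and vertex deletion.

IsProper : ∀ {C : Set} → Graph n → (Fin n → C) → Set
IsProper G f = ∀ {u v} → Adj G u v → f u ≢ f v

Colorable : Graph n → ℕ → Set
Colorable {n} G k = ∃[ f ] IsProper {C = Fin k} G f

-- The two colors are parities, so that the change of color along a walk becomes addition modulo 2.
Bipartite : Graph n → Set
Bipartite G = ∃[ f ] IsProper {C = Parity} G f

colorable-mono : (G : Graph n) → j ≤ k → Colorable G j → Colorable G k
colorable-mono G j≤k (f , proper) =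
  (λ u → inject≤ (f u) j≤k) , λ e eq → proper e (inject≤-injective j≤k j≤k _ _ eq)

bipartite⇒colorable : (G : Graph n) → Bipartite G → Colorable G 2
bipartite⇒colorable G (f , proper) = color ∘ f , λ e eq → proper e (color-injective eq)
  where
  color : Parity → Fin 2
  color 0ℙ = zero
  color 1ℙ = suc zero

  color-injective : ∀ {p q} → color p ≡ color q → p ≡ q
  color-injective {0ℙ} {0ℙ} _ = refl
  color-injective {1ℙ} {1ℙ} _ = refl

colorable⇒bipartite : (G : Graph n) → Colorable G 2 → Bipartite G
colorable⇒bipartite G (f , proper) = parity ∘ toℕ ∘ f , λ e eq → proper e (injective eq)
  where
  injective : {a b : Fin 2} → parity (toℕ a) ≡ parity (toℕ b) → a ≡ b
  injective {zero}     {zero}     _ = refl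
  injective {zero}     {suc zero} ()
  injective {suc zero} {suc zero} _ = refl

≢⇒≡punchIn : (x : Fin (suc n)) {u : Fin (suc n)} → u ≢ x → ∃[ u′ ] u ≡ punchIn x u′
≢⇒≡punchIn x u≢x = punchOut (≢-sym u≢x) , sym (punchIn-punchOut (≢-sym u≢x))

-- The deleted vertex takes a fresh color. This later bounds the indicated chromatic number of
-- `G - x` from below.
colorable-suc : (G : Graph (suc n)) (x : Fin (suc n)) → Colorable (G - x) k → Colorable G (suc k)
colorable-suc {k = k} G x (f , proper) = g , g-proper
  where
  g : Fin _ → Fin (suc k)
  g u with u ≟ x
  ... | yes _  = zero
  ... | no u≢x = suc (f (proj₁ (≢⇒≡punchIn x u≢x)))

  g-proper : IsProper G g
  g-proper {u} {v} e with u ≟ x | v ≟ x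
  ... | yes refl | yes refl = contradiction e (irrefl G refl)
  ... | yes _    | no _     = λ ()
  ... | no _     | yes _    = λ ()
  ... | no u≢x   | no v≢x   =
    proper (subst₂ (Adj G) (proj₂ (≢⇒≡punchIn x u≢x)) (proj₂ (≢⇒≡punchIn x v≢x)) e) ∘ suc-injective

-- The game

uncolored? : ∀ {A : Set} (m : Maybe A) → Dec (m ≡ nothing)
uncolored? nothing  = yes refl
uncolored? (just _) = no λ ()

≢nothing⇒≡just : ∀ {A : Set} {m : Maybe A} → m ≢ nothing → ∃[ a ] m ≡ just a
≢nothing⇒≡just {m = just a}  _ = a , refl
≢nothing⇒≡just {m = nothing} q = contradiction refl q

#uncolored : ∀ {A : Set} → Vec (Maybe A) n → ℕ
#uncolored []             = 0
#uncolored (nothing ∷ ms) = suc (#uncolored ms)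
#uncolored (just _ ∷ ms)  = #uncolored ms

#uncolored-≔ : ∀ {A : Set} (c : Vec (Maybe A) n) v {a} → lookup c v ≡ nothing →
               #uncolored (c [ v ]≔ just a) < #uncolored c
#uncolored-≔ (nothing ∷ c) zero    _  = ≤-refl
#uncolored-≔ (nothing ∷ c) (suc v) eq = s≤s (#uncolored-≔ c v eq)
#uncolored-≔ (just _ ∷ c)  (suc v) eq = #uncolored-≔ c v eq

module _ (G : Graph n) (k : ℕ) where
  open IndicatedGame G k using (Legal; BenHasWon; AnnWinsFrom; finished; select)

  -- Every round lowers `#uncolored`, so preserving `I` against all legal replies leads to a full
  -- coloring, and no position on the way is won by Ben.
  invariant⇒annWins :
    (I : PartialColoring n k → Set) →
    (∀ c → I c → ¬ BenHasWon c) →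
    (∀ c → I c → ∃[ v ] lookup c v ≡ nothing →
      ∃[ v ] lookup c v ≡ nothing × (∀ a → Legal c v a → I (c [ v ]≔ just a))) →
    ∀ c → I c → AnnWinsFrom c
  invariant⇒annWins I safe move c = go c (<-wellFounded (#uncolored c))
    where
    go : ∀ c → Acc _<_ (#uncolored c) → I c → AnnWinsFrom c
    go c (acc rs) ic with any? (λ v → uncolored? (lookup c v))
    ... | no all-colored = finished λ v → is-just (λ eq → all-colored (v , eq))
      where
      is-just : ∀ {m : Maybe (Fin k)} → m ≢ nothing → Is-just m
      is-just {just _}  _ = just _
      is-just {nothing} q = contradiction refl q
    ... | yes open-vertex = let v , eq , next = move c ic open-vertex in
      select (safe c ic) v eq λ a legal → go _ (rs (#uncolored-≔ c v eq)) (next a legal)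

  -- A single branch of the strategy tree suffices: at each selected vertex some reply is legal, and
  -- following it keeps the partial coloring proper down to a `finished` leaf.
  annWinsFrom⇒colorable :
    ∀ {c} → (∀ {u v a} → Adj G u v → lookup c u ≡ just a → lookup c v ≢ just a) →
    AnnWinsFrom c → Colorable G k
  annWinsFrom⇒colorable {c} proper (finished all-just) =
    (λ v → to-witness (all-just v)) ,
    λ {u} {v} e eq →
      proper e (witness-≡ (all-just u)) (trans (witness-≡ (all-just v)) (cong just (sym eq)))
    where
    witness-≡ : ∀ {m : Maybe (Fin k)} (p : Is-just m) → m ≡ just (to-witness p)
    witness-≡ (just _) = refl
  annWinsFrom⇒colorable {c} proper (select safe v eq next)
    with ¬∀⟶∃¬ k (λ a → ∃[ u ] Adj G v u × lookup c u ≡ just a)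
           (λ a → any? λ u → adj? G v u ×-dec ≡-dec _≟_ (lookup c u) (just a))
           (λ blocked → safe (v , eq , blocked))
  ... | a , unused = annWinsFrom⇒colorable proper′ (next a legal)
    where
    legal : Legal c v a
    legal u e eq′ = unused (u , e , eq′)

    proper′ : ∀ {u w b} → Adj G u w → lookup (c [ v ]≔ just a) u ≡ just b →
              lookup (c [ v ]≔ just a) w ≢ just b
    proper′ {u} {w} e p q with u ≟ v | w ≟ v
    ... | yes refl | yes refl = irrefl G refl e
    ... | yes refl | no w≢v   = legal w e (trans (sym (lookup∘update′ w≢v c _))
                                  (trans q (trans (sym p) (lookup∘update v c _))))
    ... | no u≢v   | yes refl = legal u (symm G e) (trans (sym (lookup∘update′ u≢v c _))
                                  (trans p (trans (sym q) (lookup∘update v c _))))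
    ... | no u≢v   | no w≢v   = proper e (trans (sym (lookup∘update′ u≢v c _)) p)
                                         (trans (sym (lookup∘update′ w≢v c _)) q)

  annWins⇒colorable : AnnWins G k → Colorable G k
  annWins⇒colorable = annWinsFrom⇒colorable λ {u} _ eq →
    contradiction (trans (sym (lookup-replicate u nothing)) eq) λ ()

opposite-unique : {a b : Fin 2} → a ≢ b → a ≡ opposite b
opposite-unique {zero}     {zero}     q = contradiction refl q
opposite-unique {zero}     {suc zero} _ = refl
opposite-unique {suc zero} {zero}     _ = refl
opposite-unique {suc zero} {suc zero} q = contradiction refl q

opposite-injective : {a b : Fin 2} → opposite a ≡ opposite b → a ≡ b
opposite-injective {zero}     {zero}     _ = refl
opposite-injective {zero}     {suc zero} ()
opposite-injective {suc zero} {suc zero} _ = refl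

-- Ann keeps the position extendable to a proper 2-coloring f: next to a
-- colored vertex Ben's move is forced to agree with f, and otherwise the
-- uncolored vertices span whole components, on which f may be flipped.
colorable⇒annWins : (G : Graph n) → Colorable G 2 → AnnWins G 2
colorable⇒annWins {n} G (f₀ , f₀-proper) = invariant⇒annWins G 2 Extendable safe move _
  (f₀ , f₀-proper , λ u eq → contradiction (trans (sym (lookup-replicate u nothing)) eq) λ ())
  where
  open IndicatedGame G 2 using (Legal; BenHasWon)

  Extends : (Fin n → Fin 2) → PartialColoring n 2 → Set
  Extends f c = ∀ u {a} → lookup c u ≡ just a → f u ≡ a

  Extendable : PartialColoring n 2 → Set
  Extendable c = ∃[ f ] IsProper G f × Extends f c

  safe : ∀ c → Extendable c → ¬ BenHasWon c
  safe c (f , proper , ext) (v , _ , blocked) =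
    let u , e , eq = blocked (f v) in proper e (sym (ext u eq))

  extends-≔ : ∀ {f} c {v a} → Extends f c → f v ≡ a → Extends f (c [ v ]≔ just a)
  extends-≔ c {v} ext fv≡a u eq with u ≟ v
  ... | yes refl = trans fv≡a (just-injective (trans (sym (lookup∘update v c _)) eq))
  ... | no u≢v   = ext u (trans (sym (lookup∘update′ u≢v c _)) eq)

  move : ∀ c → Extendable c → ∃[ v ] lookup c v ≡ nothing →
         ∃[ v ] lookup c v ≡ nothing × (∀ a → Legal c v a → Extendable (c [ v ]≔ just a))
  move c (f , proper , ext) (v₀ , eq₀)
    with any? (λ v → uncolored? (lookup c v) ×-dec
               any? (λ u → adj? G v u ×-dec ¬? (uncolored? (lookup c u))))
  ... | yes (v , eq , u , e , colored) = v , eq , forced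
    where
    forced : ∀ a → Legal c v a → Extendable (c [ v ]≔ just a)
    forced a legal with ≢nothing⇒≡just colored
    ... | b , eq′ = f , proper , extends-≔ c ext
      -- Both `f v` and `a` differ from the color `b` of the neighbor `u`, so with two colors both
      -- equal `opposite b`.
      (trans (opposite-unique (λ p → proper e (trans p (sym (ext u eq′)))))
             (sym (opposite-unique {b = b} λ { refl → legal u e eq′ })))
  ... | no separated = v₀ , eq₀ , free
    where
    g : Fin n → Fin 2
    g u with uncolored? (lookup c u)
    ... | yes _ = opposite (f u)
    ... | no  _ = f u

    g-proper : IsProper G g
    g-proper {u} {w} e with uncolored? (lookup c u) | uncolored? (lookup c w)
    ... | yes _ | yes _ = proper e ∘ opposite-injective
    ... | no _  | no _  = proper e
    ... | yes p | no q  = contradiction (u , p , w , e , q) separated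
    ... | no p  | yes q = contradiction (w , q , u , symm G e , p) separated

    g-extends : Extends g c
    g-extends u eq with uncolored? (lookup c u)
    ... | yes p = contradiction (trans (sym p) eq) λ ()
    ... | no _  = ext u eq

    g-flips : ∀ {u} → lookup c u ≡ nothing → g u ≡ opposite (f u)
    g-flips {u} eq with uncolored? (lookup c u)
    ... | yes _ = refl
    ... | no p  = contradiction eq p

    free : ∀ a → Legal c v₀ a → Extendable (c [ v₀ ]≔ just a)
    free a _ with a ≟ f v₀
    ... | yes p = f , proper , extends-≔ c ext (sym p)
    ... | no p  = g , g-proper , extends-≔ c g-extends (trans (g-flips eq₀) (sym (opposite-unique p)))

-- Walks

data Walk {A : Set} (R : Rel A 0ℓ) : ℕ → A → A → Set where
  []  : ∀ {u} → Walk R 0 u u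
  _∷_ : ∀ {u v w} → R u v → Walk R ℓ v w → Walk R (suc ℓ) u w

infixr 5 _∷_ _++_

_++_ : ∀ {A : Set} {R : Rel A 0ℓ} {u v w} → Walk R ℓ u v → Walk R ℓ′ v w → Walk R (ℓ + ℓ′) u w
[]      ++ q = q
(e ∷ p) ++ q = e ∷ (p ++ q)

module _ {A : Set} {R : Rel A 0ℓ} where

  -- Past the end of the walk, the last vertex is repeated.
  at : ∀ {u v} → Walk R ℓ u v → ℕ → A
  at {u = u} _ zero    = u
  at {v = v} []      (suc _) = v
  at         (_ ∷ p) (suc i) = at p i

  at-end : ∀ {u v} (p : Walk R ℓ u v) → at p ℓ ≡ v
  at-end []      = refl
  at-end (_ ∷ p) = at-end p

  at-step : ∀ {u v} (p : Walk R ℓ u v) → i < ℓ → R (at p i) (at p (suc i))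
  at-step {i = zero}  (e ∷ _) _         = e
  at-step {i = suc _} (_ ∷ p) (s≤s i<ℓ) = at-step p i<ℓ

  segment : ∀ {u v} (p : Walk R ℓ u v) → i ≤ j → j ≤ ℓ → Walk R (j ∸ i) (at p i) (at p j)
  segment p       (z≤n {zero})  _         = []
  segment (e ∷ p) (z≤n {suc j}) (s≤s j≤ℓ) = e ∷ segment p z≤n j≤ℓ
  segment (_ ∷ p) (s≤s i≤j)     (s≤s j≤ℓ) = segment p i≤j j≤ℓ

  -- This is the other arc of a closed walk: from position `j` on to the base point, then from the
  -- base point to position `i`.
  complement : ∀ {u} (p : Walk R ℓ u u) → i ≤ j → j ≤ ℓ → Walk R ((ℓ ∸ j) + i) (at p j) (at p i)
  complement {ℓ} {i} p i≤j j≤ℓ =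
    subst (Walk R _ _) (at-end p) (segment p j≤ℓ ≤-refl) ++ segment p z≤n (≤-trans i≤j j≤ℓ)

walk-map : ∀ {A B : Set} {R : Rel A 0ℓ} {S : Rel B 0ℓ} (f : A → B) →
           (∀ {u v} → R u v → S (f u) (f v)) →
           ∀ {u v} → Walk R ℓ u v → Walk S ℓ (f u) (f v)
walk-map f hom []      = []
walk-map f hom (e ∷ p) = hom e ∷ walk-map f hom p

walk? : {R : Rel (Fin n) 0ℓ} → Decidable R → ∀ ℓ → Decidable (Walk R ℓ)
walk? R? zero u v with u ≟ v
... | yes refl = yes []
... | no u≢v   = no λ { [] → u≢v refl }
walk? R? (suc ℓ) u v with any? (λ w → R? u w ×-dec walk? R? ℓ w v)
... | yes (_ , e , p) = yes (e ∷ p)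
... | no none         = no λ { (e ∷ p) → none (_ , e , p) }

-- Odd closed walks and bipartiteness.

≢⇒≡⁻¹ : ∀ {p q} → p ≢ q → q ≡ p ⁻¹
≢⇒≡⁻¹ {0ℙ} {0ℙ} r = contradiction refl r
≢⇒≡⁻¹ {0ℙ} {1ℙ} _ = refl
≢⇒≡⁻¹ {1ℙ} {0ℙ} _ = refl
≢⇒≡⁻¹ {1ℙ} {1ℙ} r = contradiction refl r

parity-suc : ∀ n → parity (suc n) ≡ parity n ⁻¹
parity-suc n = ⁻¹-injective (trans (suc-homo-⁻¹ n) (sym (⁻¹-involutive (parity n))))

-- Each edge flips the parity color, so only the length of the walk modulo 2 counts.
walk-color : (G : Graph n) {f : Fin n → Parity} → IsProper G f →
             ∀ {u v} → Walk (Adj G) ℓ u v → f v ≡ parity ℓ ℙ.+ f u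
walk-color G proper []                         = refl
walk-color {ℓ = suc ℓ} G {f} proper {u} (e ∷ p) =
  trans (walk-color G proper p) (trans (cong (parity ℓ ℙ.+_) (≢⇒≡⁻¹ (proper e)))
    (trans (shift (parity ℓ) (f u)) (cong (ℙ._+ f u) (sym (parity-suc ℓ)))))
  where
  shift : ∀ p q → p ℙ.+ q ⁻¹ ≡ p ⁻¹ ℙ.+ q
  shift 0ℙ q = refl
  shift 1ℙ q = ⁻¹-involutive q

OddClosedWalk : Graph n → ℕ → Set
OddClosedWalk G ℓ = parity ℓ ≡ 1ℙ × ∃[ u ] Walk (Adj G) ℓ u u

-- Needed for `least` to extract a shortest odd closed walk.
oddClosedWalk? : (G : Graph n) → Decidable₁ (OddClosedWalk G)
oddClosedWalk? G ℓ = (parity ℓ ≟ℙ 1ℙ) ×-dec any? (λ u → walk? (adj? G) ℓ u u)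

bipartite⇒no-oddClosedWalk : (G : Graph n) → Bipartite G → ¬ OddClosedWalk G ℓ
bipartite⇒no-oddClosedWalk G (f , proper) (odd , u , p) =
  p≢p⁻¹ (f u) (trans (walk-color G proper p) (cong (ℙ._+ f u) odd))

module _ {R : Rel (Fin n) 0ℓ} (R? : Decidable R) {P : Pred (Fin n) 0ℓ} (P? : Decidable₁ P) where

  Reachable : Pred (Fin n) 0ℓ
  Reachable v = ∃[ u ] P u × ∃[ ℓ ] Walk R ℓ u v

  -- Starting from the empty set, a missing source or out-neighbor is added as long as there is one;
  -- this stops because a subset of `Fin n` cannot grow forever. The result is a finite subset
  -- because its membership is decidable, whereas `Reachable` quantifies over walks of unbounded
  -- length.
  reachable-set : ∃[ T ] (∀ {v} → P v → v ∈ T) × (∀ {u v} → u ∈ T → R u v → v ∈ T) ×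
                         (∀ {v} → v ∈ T → Reachable v)
  reachable-set = grow ∅ (⊃-wellFounded ∅) λ v∈∅ → contradiction v∈∅ ∉⊥
    where
    grow : ∀ T → Acc _⊃_ T → (∀ {v} → v ∈ T → Reachable v) →
           ∃[ T ] (∀ {v} → P v → v ∈ T) × (∀ {u v} → u ∈ T → R u v → v ∈ T) ×
                  (∀ {v} → v ∈ T → Reachable v)
    grow T (acc rs) reach
      with any? (λ v → ¬? (v ∈? T) ×-dec (P? v ⊎-dec any? (λ u → (u ∈? T) ×-dec R? u v)))
    ... | no closed =
      T , (λ {v} pv → inside v (inj₁ pv)) , (λ {u} {v} u∈T r → inside v (inj₂ (u , u∈T , r))) , reach
      where
      inside : ∀ v → P v ⊎ (∃[ u ] u ∈ T × R u v) → v ∈ T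
      inside v why with v ∈? T
      ... | yes v∈T = v∈T
      ... | no v∉T  = contradiction (v , v∉T , why) closed
    ... | yes (v , v∉T , why) =
      grow (T ∪ ⁅ v ⁆) (rs (p⊆p∪q ⁅ v ⁆ , v , x∈p∪q⁺ (inj₂ (x∈⁅x⁆ v)) , v∉T)) reach′
      where
      reach-v : P v ⊎ (∃[ u ] u ∈ T × R u v) → Reachable v
      reach-v (inj₁ pv) = v , pv , 0 , []
      reach-v (inj₂ (u , u∈T , r)) = let s , ps , ℓ , p = reach u∈T in s , ps , ℓ + 1 , p ++ r ∷ []

      reach′ : ∀ {w} → w ∈ T ∪ ⁅ v ⁆ → Reachable w
      reach′ w∈ with x∈p∪q⁻ T ⁅ v ⁆ w∈
      ... | inj₁ w∈T = reach w∈T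
      ... | inj₂ w∈v with refl ← x∈⁅y⁆⇒x≡y v w∈v = reach-v why

-- Let f be a 2-coloring of G - 0.  If no walk of G - 0 joins two neighbors of
-- 0 of different colors, then flipping f on the component of every neighbor
-- colored 0ℙ leaves 1ℙ on all neighbors of 0, and G is bipartite.
oddClosedWalk : (G : Graph (suc n)) → Bipartite (G - zero) → ¬ Bipartite G → ∃ (OddClosedWalk G)
oddClosedWalk {n} G (f , proper) not-bipartite = result
  where
  source? : Decidable₁ (λ u → Adj G zero (suc u) × f u ≡ 0ℙ)
  source? u = adj? G zero (suc u) ×-dec (f u ≟ℙ 0ℙ)

  result : ∃ (OddClosedWalk G)
  result with reachable-set (adj? (G - zero)) source?
  ... | T , source , closed , reach
    with any? (λ v → (v ∈? T) ×-dec (adj? G zero (suc v) ×-dec (f v ≟ℙ 1ℙ)))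
  -- The walk leaves 0 to `u`, follows `p` to `v` and returns to 0. The colors `0ℙ` of `u` and `1ℙ`
  -- of `v` make `ℓ` odd, and the two extra edges keep the length odd.
  ... | yes (v , v∈T , e , fv) = let u , (e′ , fu) , ℓ , p = reach v∈T in
        suc (ℓ + 1) ,
        odd ℓ (trans (sym fv) (trans (walk-color (G - zero) proper p) (cong (parity ℓ ℙ.+_) fu))) ,
        zero , (e′ ∷ walk-map suc id p ++ symm G e ∷ [])
    where
    odd : ∀ ℓ → 1ℙ ≡ parity ℓ ℙ.+ 0ℙ → parity (suc (ℓ + 1)) ≡ 1ℙ
    odd ℓ eq rewrite +-comm ℓ 1 = trans (sym (ℙ.+-identityʳ (parity ℓ))) (sym eq)
  ... | no none = ⊥-elim (not-bipartite (g , λ {u} {v} → g-proper {u} {v}))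
    where
    flipOn : ∀ {Q : Set} → Dec Q → Parity → Parity
    flipOn (yes _) p = p ⁻¹
    flipOn (no _)  p = p

    g : Fin (suc n) → Parity
    g zero    = 0ℙ
    g (suc v) = flipOn (v ∈? T) (f v)

    neighbor : ∀ v → Adj G zero (suc v) → g (suc v) ≡ 1ℙ
    neighbor v e with v ∈? T | f v in eq
    ... | yes _  | 0ℙ = refl
    ... | yes v∈T | 1ℙ = contradiction (v , v∈T , e , eq) none
    ... | no v∉T | 0ℙ = contradiction (source (e , eq)) v∉T
    ... | no _ | 1ℙ = refl

    0≢1 : ∀ {p} → p ≡ 1ℙ → 0ℙ ≢ p
    0≢1 refl ()

    g-proper : IsProper G g
    g-proper {zero}  {zero}  e = contradiction e (irrefl G refl)
    g-proper {zero}  {suc v} e = 0≢1 (neighbor v e)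
    g-proper {suc u} {zero}  e = ≢-sym (0≢1 (neighbor u (symm G e)))
    g-proper {suc u} {suc v} e with u ∈? T | v ∈? T
    ... | yes _ | yes _ = proper e ∘ ⁻¹-injective
    ... | no _  | no _  = proper e
    ... | yes p | no q  = contradiction (closed p e) q
    ... | no q  | yes p = contradiction (closed p (symm G e)) q

-- Shortest odd closed walks.

least : {Q : Pred ℕ 0ℓ} → Decidable₁ Q → ∃ Q → ∃[ ℓ ] Q ℓ × (∀ {j} → j < ℓ → ¬ Q j)
least {Q} Q? (ℓ , q) = go ℓ (<-wellFounded ℓ) q
  where
  go : ∀ ℓ → Acc _<_ ℓ → Q ℓ → ∃[ ℓ ] Q ℓ × (∀ {j} → j < ℓ → ¬ Q j)
  go ℓ (acc rs) q with anyUpTo? Q? ℓ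
  ... | yes (j , j<ℓ , qj) = go j (rs j<ℓ) qj
  ... | no none            = ℓ , q , λ j<ℓ qj → none (_ , j<ℓ , qj)

odd-+ : ∀ a b → parity (a + b) ≡ 1ℙ → parity a ≡ 1ℙ ⊎ parity b ≡ 1ℙ
odd-+ a b odd with parity a | +-homo-+ a b
... | 0ℙ | eq = inj₂ (trans (sym eq) odd)
... | 1ℙ | _  = inj₁ refl

odd⇒≡2*m+1 : ∀ ℓ → parity ℓ ≡ 1ℙ → ∃[ m ] ℓ ≡ 2 * m + 1
odd⇒≡2*m+1 1             _   = 0 , refl
odd⇒≡2*m+1 (suc (suc ℓ)) odd with m , eq ← odd⇒≡2*m+1 ℓ odd =
  suc m , trans (cong (2 +_) eq) (cong (λ s → suc s + 1) (sym (+-suc m (m + 0))))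

module ShortestOddClosedWalk (G : Graph n) {u} (p : Walk (Adj G) ℓ u u) (odd : parity ℓ ≡ 1ℙ)
                             (shortest : ∀ {j} → j < ℓ → ¬ OddClosedWalk G j) where

  -- The summands are the lengths of `segment` and `complement`, the two arcs between positions `i`
  -- and `j`.
  arcs-sum : i < j → j < ℓ → (j ∸ i) + ((ℓ ∸ j) + i) ≡ ℓ
  arcs-sum {i} {j} i<j j<ℓ = begin
    (j ∸ i) + ((ℓ ∸ j) + i)  ≡⟨ cong ((j ∸ i) +_) (+-comm (ℓ ∸ j) i) ⟩
    (j ∸ i) + (i + (ℓ ∸ j))  ≡⟨ +-assoc (j ∸ i) i (ℓ ∸ j) ⟨
    (j ∸ i) + i + (ℓ ∸ j)    ≡⟨ cong (_+ (ℓ ∸ j)) (m∸n+n≡m (<⇒≤ i<j)) ⟩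
    j + (ℓ ∸ j)              ≡⟨ m+[n∸m]≡n (<⇒≤ j<ℓ) ⟩
    ℓ                        ∎
    where open ≡-Reasoning

  -- A repeated vertex would make both arcs closed walks. One of them is odd because the lengths sum
  -- to the odd `ℓ`, and it is shorter than `ℓ` because the other arc is nonempty.
  at-distinct : i < j → j < ℓ → at p i ≢ at p j
  at-distinct {i} {j} i<j j<ℓ eq
    with odd-+ (j ∸ i) ((ℓ ∸ j) + i) (trans (cong parity (arcs-sum i<j j<ℓ)) odd)
  ... | inj₁ odd₁ = shortest
    (subst (j ∸ i <_) (arcs-sum i<j j<ℓ)
      (m<m+n (j ∸ i) (<-≤-trans (m<n⇒0<n∸m j<ℓ) (m≤m+n (ℓ ∸ j) i))))
    (odd₁ , at p i , subst (Walk (Adj G) _ (at p i)) (sym eq) (segment p (<⇒≤ i<j) (<⇒≤ j<ℓ)))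
  ... | inj₂ odd₂ = shortest
    (subst ((ℓ ∸ j) + i <_) (arcs-sum i<j j<ℓ) (m<n+m ((ℓ ∸ j) + i) (m<n⇒0<n∸m i<j)))
    (odd₂ , at p j , subst (Walk (Adj G) _ (at p j)) eq (complement p (<⇒≤ i<j) (<⇒≤ j<ℓ)))

  -- A chord closes both arcs between its ends; since the resulting lengths
  -- add up to ℓ + 2, one of these closed walks is odd.
  chord : i < j → j < ℓ → Adj G (at p i) (at p j) → j ∸ i ≤ 1 ⊎ (ℓ ∸ j) + i ≤ 1
  chord {i} {j} i<j j<ℓ e = result
    where
    a = j ∸ i
    b = (ℓ ∸ j) + i

    sum : a + b ≡ ℓ
    sum = arcs-sum i<j j<ℓ

    result : a ≤ 1 ⊎ b ≤ 1
    result
      with odd-+ (suc a) (suc b)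
             (trans (cong (parity ∘ suc) (+-suc a b)) (trans (cong parity sum) odd))
    -- Minimality gives `ℓ ≤ suc a`; since `ℓ` is `a + b`, cancelling `a` leaves `b ≤ 1`. The other
    -- case is symmetric.
    ... | inj₁ odd₁ = inj₂ (+-cancelˡ-≤ a b 1 (subst₂ _≤_ (sym sum) (+-comm 1 a)
            (≮⇒≥ λ lt → shortest lt (odd₁ , at p j , symm G e ∷ segment p (<⇒≤ i<j) (<⇒≤ j<ℓ)))))
    ... | inj₂ odd₂ = inj₁ (+-cancelʳ-≤ b a 1 (subst (_≤ suc b) (sym sum)
            (≮⇒≥ λ lt → shortest lt (odd₂ , at p i , e ∷ complement p (<⇒≤ i<j) (<⇒≤ j<ℓ)))))

  -- One of the arcs has length at most 1. If it is the direct one, `b` follows `a`; if it runs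
  -- through the base point, then `b` is the last position and `a` is 0.
  chord⇒cycle-adj : (a b : Fin ℓ) → toℕ a < toℕ b →
                    Adj G (at p (toℕ a)) (at p (toℕ b)) → Next a b ⊎ Next b a
  chord⇒cycle-adj a b a<b e with chord a<b (toℕ<n b) e
  ... | inj₁ b∸a≤1 = inj₁ (inj₁ (≤-antisym b≤1+a a<b))
    where
    b≤1+a : toℕ b ≤ suc (toℕ a)
    b≤1+a = subst (_≤ suc (toℕ a)) (m∸n+n≡m (<⇒≤ a<b)) (+-monoˡ-≤ (toℕ a) b∸a≤1)
  ... | inj₂ arc≤1 = inj₂ (inj₂ (≤-antisym (toℕ<n b) ℓ≤1+b , n≤0⇒n≡0 a≤0))
    where
    ℓ≤1+b : ℓ ≤ suc (toℕ b)
    ℓ≤1+b = subst (_≤ suc (toℕ b)) (m∸n+n≡m (<⇒≤ (toℕ<n b)))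
      (+-monoˡ-≤ (toℕ b) (≤-trans (m≤m+n (ℓ ∸ toℕ b) (toℕ a)) arc≤1))

    a≤0 : toℕ a ≤ 0
    a≤0 = +-cancelˡ-≤ 1 (toℕ a) 0
      (≤-trans (+-monoˡ-≤ (toℕ a) (m<n⇒0<n∸m (toℕ<n b))) arc≤1)

  vertex : Fin ℓ → Fin n
  vertex a = at p (toℕ a)

  vertex-injective : ∀ {a b} → vertex a ≡ vertex b → a ≡ b
  vertex-injective {a} {b} eq with <-cmp (toℕ a) (toℕ b)
  ... | tri< a<b _ _ = contradiction eq (at-distinct a<b (toℕ<n b))
  ... | tri≈ _ a≡b _ = toℕ-injective a≡b
  ... | tri> _ _ b<a = contradiction (sym eq) (at-distinct b<a (toℕ<n a))

  adj⇒cycle-adj : ∀ a b → Adj G (vertex a) (vertex b) → Adj (cycle ℓ) a b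
  adj⇒cycle-adj a b e with <-cmp (toℕ a) (toℕ b)
  ... | tri< a<b a≢b _ = a≢b ∘ cong toℕ , chord⇒cycle-adj a b a<b e
  ... | tri≈ _ a≡b _   = contradiction e (irrefl G (cong (at p) a≡b))
  ... | tri> _ a≢b b<a = a≢b ∘ cong toℕ , [ inj₂ , inj₁ ]′ (chord⇒cycle-adj b a b<a (symm G e))

  next⇒adj : ∀ a b → Next a b → Adj G (vertex a) (vertex b)
  next⇒adj a b (inj₁ b≡1+a) =
    subst (λ i → Adj G (vertex a) (at p i)) (sym b≡1+a) (at-step p (toℕ<n a))
  next⇒adj a b (inj₂ (1+a≡ℓ , b≡0)) =
    subst (Adj G (vertex a)) (trans (cong (at p) 1+a≡ℓ) (trans (at-end p) (sym (cong (at p) b≡0))))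
      (at-step p (toℕ<n a))

  cycle-adj⇒adj : ∀ a b → Adj (cycle ℓ) a b → Adj G (vertex a) (vertex b)
  cycle-adj⇒adj a b (_ , inj₁ next) = next⇒adj a b next
  cycle-adj⇒adj a b (_ , inj₂ next) = symm G (next⇒adj b a next)

  ≅cycle : (∀ x → ∃[ a ] vertex a ≡ x) → G ≅ cycle ℓ
  ≅cycle surjective = record
    { bijection = mk↔ₛ′ index vertex (λ a → vertex-injective (vertex-index (vertex a))) vertex-index
    ; adj-⇔     = λ x y → mk⇔
        (λ e → adj⇒cycle-adj (index x) (index y)
                 (subst₂ (Adj G) (sym (vertex-index x)) (sym (vertex-index y)) e))
        (λ e → subst₂ (Adj G) (vertex-index x) (vertex-index y) (cycle-adj⇒adj (index x) (index y) e))
    }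
    where
    index : Fin n → Fin ℓ
    index x = proj₁ (surjective x)

    vertex-index : ∀ x → vertex (index x) ≡ x
    vertex-index x = proj₂ (surjective x)

-- Only the start is given as a vertex of `G - x`; the preimage of the end under `punchIn x` is
-- found by following the walk, so it is part of the result.
walk-avoiding : (G : Graph (suc n)) (x : Fin (suc n)) {u : Fin n} {v : Fin (suc n)}
                (p : Walk (Adj G) ℓ (punchIn x u) v) → (∀ {i} → i ≤ ℓ → at p i ≢ x) →
                ∃[ v′ ] v ≡ punchIn x v′ × Walk (Adj (G - x)) ℓ u v′
walk-avoiding G x []      _     = _ , refl , []
walk-avoiding G x (e ∷ p) avoid with ≢⇒≡punchIn x (avoid (s≤s z≤n))
... | _ , refl = let v′ , eq , p′ = walk-avoiding G x p (avoid ∘ s≤s) in v′ , eq , e ∷ p′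

closedWalk-avoiding : (G : Graph (suc n)) (x : Fin (suc n)) {u : Fin (suc n)}
                      (p : Walk (Adj G) ℓ u u) → (∀ {i} → i ≤ ℓ → at p i ≢ x) →
                      ∃[ v ] Walk (Adj (G - x)) ℓ v v
closedWalk-avoiding G x p avoid with ≢⇒≡punchIn x (avoid z≤n)
... | u′ , refl with walk-avoiding G x p avoid
... | v′ , eq , p′ with refl ← punchIn-injective x u′ v′ eq = u′ , p′

vertexCritical⇒oddCycle : (G : Graph n) → ¬ Bipartite G → (∀ x → Bipartite (G - x)) →
                          IsOddCycle G
vertexCritical⇒oddCycle {zero}  G not-bipartite _ = ⊥-elim (not-bipartite ((λ ()) , λ { {()} }))
vertexCritical⇒oddCycle {suc n} G not-bipartite deleted
  with least (oddClosedWalk? G) (oddClosedWalk G (deleted zero) not-bipartite)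
... | ℓ , (odd , u , p) , shortest with odd⇒≡2*m+1 ℓ odd
... | m , refl = m , positive m p , S.≅cycle surjective
  where
  module S = ShortestOddClosedWalk G p odd shortest

  positive : ∀ m → Walk (Adj G) (2 * m + 1) u u → 1 ≤ m
  -- A closed walk of length 1 would be a loop.
  positive zero    (e ∷ []) = contradiction e (irrefl G refl)
  positive (suc _) _        = s≤s z≤n

  surjective : ∀ x → ∃[ a ] S.vertex a ≡ x
  surjective x with any? (λ a → S.vertex a ≟ x)
  ... | yes found = found
  ... | no missed = ⊥-elim (bipartite⇒no-oddClosedWalk (G - x) (deleted x)
                      (odd , closedWalk-avoiding G x p avoid))
    where
    avoid< : ∀ {i} → i < ℓ → at p i ≢ x
    avoid< i<ℓ eq = missed (fromℕ< i<ℓ , trans (cong (at p) (toℕ-fromℕ< i<ℓ)) eq)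

    avoid : ∀ {i} → i ≤ ℓ → at p i ≢ x
    avoid {i} i≤ℓ with m≤n⇒m<n∨m≡n i≤ℓ
    ... | inj₁ i<ℓ  = avoid< i<ℓ
    -- Position `ℓ` carries the same vertex as position 0, and 0 lies below the odd `ℓ`.
    ... | inj₂ refl = avoid< (m≤n+m 1 (2 * m)) ∘ trans (sym (at-end p))

-- Cycles

-- Colors alternate along 0, 1, ..., `k`, so the even `k` gets the color of 0, although the closing
-- edge joins them. The bound `1 ≤ k` makes these two vertices distinct.
cycle-not-bipartite : 1 ≤ k → parity k ≡ 0ℙ → ¬ Bipartite (cycle (suc k))
cycle-not-bipartite {suc k} _ even (f , proper) =
  proper ((λ ()) , inj₂ (inj₂ (cong suc (toℕ-fromℕ (suc k)) , refl)))
    (sym (trans (color (fromℕ (suc k)))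
      (cong (ℙ._+ f zero) (trans (cong parity (toℕ-fromℕ (suc k))) even))))
  where
  inject₁≢suc : ∀ {n} (i : Fin n) → inject₁ i ≢ suc i
  inject₁≢suc zero    ()
  inject₁≢suc (suc i) eq = inject₁≢suc i (suc-injective eq)

  ⁻¹-+ : ∀ p q → (p ℙ.+ q) ⁻¹ ≡ p ⁻¹ ℙ.+ q
  ⁻¹-+ 0ℙ q = refl
  ⁻¹-+ 1ℙ q = ⁻¹-involutive q

  color : ∀ i → f i ≡ parity (toℕ i) ℙ.+ f zero
  color = <-weakInduction _ refl λ i ih →
    trans (≢⇒≡⁻¹ (proper (inject₁≢suc i , inj₁ (inj₁ (cong suc (sym (toℕ-inject₁ i)))))))
      (trans (cong _⁻¹ ih) (trans (⁻¹-+ (parity (toℕ (inject₁ i))) (f zero))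
        (cong (ℙ._+ f zero)
          (trans (sym (parity-suc (toℕ (inject₁ i)))) (cong (parity ∘ suc) (toℕ-inject₁ i))))))

-- Parity is proper except on the edge joining the even vertices k and 0, so the
-- vertices before y are flipped; the flip is not seen elsewhere as y is missing.
module _ (even : parity k ≡ 0ℙ) (y : Fin (suc k)) where

  pathColor : Fin (suc k) → Parity
  pathColor w with toℕ w <? toℕ y
  ... | yes _ = parity (toℕ w) ⁻¹
  ... | no _  = parity (toℕ w)

  pathColor-next : ∀ {u w} → u ≢ y → w ≢ y → Next u w → pathColor u ≢ pathColor w
  pathColor-next {u} {w} u≢y w≢y (inj₁ w≡1+u) = step
    where
    flips : parity (toℕ u) ≢ parity (toℕ w)
    flips rewrite w≡1+u | parity-suc (toℕ u) = p≢p⁻¹ _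

    step : pathColor u ≢ pathColor w
    step with toℕ u <? toℕ y | toℕ w <? toℕ y
    ... | yes _   | yes _   = flips ∘ ⁻¹-injective
    ... | no _    | no _    = flips
    -- As `w` is the successor of `u`, the flipped range can end between them only if `w` is `y`.
    ... | yes u<y | no w≮y  = contradiction
      (toℕ-injective (≤-antisym (subst (_≤ toℕ y) (sym w≡1+u) u<y) (≮⇒≥ w≮y))) w≢y
    ... | no u≮y  | yes w<y = contradiction
      (<-trans (subst (toℕ u <_) (sym w≡1+u) ≤-refl) w<y) u≮y
  pathColor-next {u} {w} u≢y w≢y (inj₂ (1+u≡n , w≡0)) with toℕ u <? toℕ y | toℕ w <? toℕ y
  -- Here `u` is the last vertex, which precedes no vertex in the numbering.
  ... | yes u<y | _      = contradiction (subst (toℕ y <_) (sym 1+u≡n) (toℕ<n y)) (≤⇒≯ u<y)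
  ... | no _    | no w≮y = contradiction
    (toℕ-injective (trans w≡0 (sym (n≤0⇒n≡0 (subst (toℕ y ≤_) w≡0 (≮⇒≥ w≮y)))))) w≢y
  ... | no _    | yes _  rewrite w≡0 | cong (parity ∘ pred) 1+u≡n | even = λ ()

  pathColor-proper : ∀ {u w} → u ≢ y → w ≢ y → Adj (cycle (suc k)) u w → pathColor u ≢ pathColor w
  pathColor-proper u≢y w≢y (_ , inj₁ next) = pathColor-next u≢y w≢y next
  pathColor-proper u≢y w≢y (_ , inj₂ next) = ≢-sym (pathColor-next w≢y u≢y next)

Next-functional : ∀ {a b c : Fin n} → Next a b → Next a c → b ≡ c
Next-functional (inj₁ b≡) (inj₁ c≡) = toℕ-injective (trans b≡ (sym c≡))
Next-functional (inj₂ (_ , b≡)) (inj₂ (_ , c≡)) = toℕ-injective (trans b≡ (sym c≡))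
Next-functional {b = b} (inj₁ b≡) (inj₂ (1+a≡n , _)) = contradiction (trans b≡ 1+a≡n) (<⇒≢ (toℕ<n b))
Next-functional {c = c} (inj₂ (1+a≡n , _)) (inj₁ c≡) = contradiction (trans c≡ 1+a≡n) (<⇒≢ (toℕ<n c))

Next-injective : ∀ {a b c : Fin n} → Next b a → Next c a → b ≡ c
Next-injective (inj₁ b≡) (inj₁ c≡) = toℕ-injective (suc-injectiveℕ (trans (sym b≡) c≡))
Next-injective (inj₂ (b≡ , _)) (inj₂ (c≡ , _)) = toℕ-injective (suc-injectiveℕ (trans b≡ (sym c≡)))
Next-injective (inj₁ b≡) (inj₂ (_ , a≡0)) = contradiction (trans (sym a≡0) b≡) λ ()
Next-injective (inj₂ (_ , a≡0)) (inj₁ c≡) = contradiction (trans (sym a≡0) c≡) λ ()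

-- By the pigeonhole principle two of the three neighbors are both successors or both predecessors
-- of `y`, and each of these is unique.
cycle-neighbors : ∀ {y : Fin n} (z : Fin 3 → Fin n) → (∀ a → Adj (cycle n) y (z a)) →
                  ∃[ a ] ∃[ b ] a ≢ b × z a ≡ z b
cycle-neighbors z adj with proj₂ (adj zero) | proj₂ (adj (suc zero)) | proj₂ (adj (suc (suc zero)))
... | inj₁ p | inj₁ q | _      = _ , _ , (λ ()) , Next-functional p q
... | inj₂ p | inj₂ q | _      = _ , _ , (λ ()) , Next-injective p q
... | inj₁ p | inj₂ _ | inj₁ q = _ , _ , (λ ()) , Next-functional p q
... | inj₁ _ | inj₂ p | inj₂ q = _ , _ , (λ ()) , Next-injective p q
... | inj₂ _ | inj₁ p | inj₁ q = _ , _ , (λ ()) , Next-functional p q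
... | inj₂ p | inj₁ _ | inj₂ q = _ , _ , (λ ()) , Next-injective p q

module _ {G : Graph n} {m} (iso : G ≅ cycle m) where
  open _≅_ iso
  open Inverse bijection using (to; from; strictlyInverseˡ; strictlyInverseʳ)

  to-injective : ∀ {u v} → to u ≡ to v → u ≡ v
  to-injective {u} {v} eq = trans (sym (strictlyInverseʳ u)) (trans (cong from eq) (strictlyInverseʳ v))

  -- Any order of selection wins, so the invariant is trivial: blocking a vertex takes three
  -- neighbors of different colors, but two of them coincide by `cycle-neighbors`.
  ≅cycle⇒annWins : AnnWins G 3
  ≅cycle⇒annWins =
    invariant⇒annWins G 3 (λ _ → ⊤) (λ c _ → safe c) (λ { _ _ (v , eq) → v , eq , _ }) _ _
    where
    open IndicatedGame G 3 using (BenHasWon)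

    safe : ∀ c → ¬ BenHasWon c
    safe c (v , _ , blocked)
      with cycle-neighbors (to ∘ proj₁ ∘ blocked)
             (λ a → Equivalence.to (adj-⇔ v (proj₁ (blocked a))) (proj₁ (proj₂ (blocked a))))
    ... | a , b , a≢b , eq = a≢b (just-injective
      (trans (sym (proj₂ (proj₂ (blocked a))))
        (trans (cong (lookup c) (to-injective eq)) (proj₂ (proj₂ (blocked b))))))

  ≅cycle-bipartite : Bipartite G → Bipartite (cycle m)
  ≅cycle-bipartite (f , proper) = f ∘ from , λ {i} {j} e →
    proper (Equivalence.from (adj-⇔ (from i) (from j))
      (subst₂ (Adj (cycle m)) (sym (strictlyInverseˡ i)) (sym (strictlyInverseˡ j)) e))

≅cycle-delete-bipartite : {G : Graph n} → G ≅ cycle (suc k) → parity k ≡ 0ℙ → ∀ x → Bipartite (G - x)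
≅cycle-delete-bipartite {suc n} {k} {G} iso even x =
  pathColor even (to x) ∘ to ∘ punchIn x , λ {u} {v} e →
    pathColor-proper even (to x) (avoids u) (avoids v) (Equivalence.to (adj-⇔ _ _) e)
  where
  open _≅_ iso
  open Inverse bijection using (to)

  avoids : ∀ u → to (punchIn x u) ≢ to x
  avoids u eq = punchInᵢ≢i x u (to-injective iso eq)

-- Lower bounds and the two implications.

-- The argument passes through colorability, which is monotone in the number of colors, and so
-- avoids any comparison of games with different numbers of colors.
annWins-bound : (G : Graph n) → ¬ Bipartite G → ∀ j → AnnWins G j → 3 ≤ j
annWins-bound G not-bipartite j win = ≰⇒> λ j≤2 →
  not-bipartite (colorable⇒bipartite G (colorable-mono G j≤2 (annWins⇒colorable G j win)))

-- A win on `G - x` with at most one color, together with a fresh color for `x`, would 2-color `G`.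
annWins-delete-bound : (G : Graph n) → ¬ Bipartite G → ∀ x j → AnnWins (G - x) j → 2 ≤ j
annWins-delete-bound {suc n} G not-bipartite x j win = ≰⇒> λ j≤1 →
  not-bipartite (colorable⇒bipartite G
    (colorable-mono G (s≤s j≤1) (colorable-suc G x (annWins⇒colorable (G - x) j win))))

critical⇒oddCycle : (G : Graph n) → IsLowerGameVertexCritical 3 G → IsOddCycle G
critical⇒oddCycle G ((_ , minimal) , deleted) = vertexCritical⇒oddCycle G
  (λ bip → contradiction (minimal 2 (colorable⇒annWins G (bipartite⇒colorable G bip)))
             λ { (s≤s (s≤s ())) })
  (λ x → let j , (win , _) , j<3 = deleted x in
    colorable⇒bipartite (G - x)
      (colorable-mono (G - x) (≤-pred j<3) (annWins⇒colorable (G - x) j win)))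

-- The odd length is written `suc k` with `k` even, so that the cycle visibly has a vertex `zero`
-- and a last vertex numbered `k`.
≅oddCycle⇒critical : (G : Graph n) → 1 ≤ k → parity k ≡ 0ℙ → G ≅ cycle (suc k) →
                     IsLowerGameVertexCritical 3 G
≅oddCycle⇒critical G 1≤k even iso =
  (≅cycle⇒annWins iso , annWins-bound G not-bipartite) ,
  λ x → 2 ,
    (colorable⇒annWins (G - x) (bipartite⇒colorable (G - x) (≅cycle-delete-bipartite iso even x)) ,
     annWins-delete-bound G not-bipartite x) ,
    ≤-refl
  where
  not-bipartite : ¬ Bipartite G
  not-bipartite = cycle-not-bipartite 1≤k even ∘ ≅cycle-bipartite iso

oddCycle⇒critical : (G : Graph n) → IsOddCycle G → IsLowerGameVertexCritical 3 G
oddCycle⇒critical G (m , 1≤m , iso) = ≅oddCycle⇒critical G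
  -- By `*-homo-*`, `parity (2 * m)` equals the product of `parity 2` and `parity m`, which reduces
  -- to `0ℙ`.
  (≤-trans 1≤m (m≤m+n m (m + 0))) (*-homo-* 2 m) (subst (λ ℓ → G ≅ cycle ℓ) (+-comm (2 * m) 1) iso)

theorem13 : ∀ (n : ℕ) (G : Graph n) → IsLowerGameVertexCritical 3 G ⇔ IsOddCycle G
theorem13 n G = mk⇔ (critical⇒oddCycle G) (oddCycle⇒critical G)
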